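{- Let $n\ge3$ and let $\lambda=(\lambda_1,\lambda_2)$ be a two-row partition of $n$ ($\lambda_1\ge\lambda_2\ge1$). Then $U(\overline\Gamma_\lambda)=\overline{\mathcal D}_\lambda$ as $[1,n]$-labeled graphs.
   Context: **Conventions.** For $k\in\mathbb Z$, $\overline{k}$ is the unique element of $\{1,\dots,n\}$ congruent to $k$ modulo $n$; $[1,n]=\{1,\dots,n\}$. For $a,b\in[1,n]$, $\langle a,b\rangle$ is $\emptyset$ if $a=\overline{b+1}$, and otherwise the cyclic interval $\{a,\overline{a+1},\dots,b\}$. **Tableaux.** $\mathrm{RSYT}(\lambda)$ is the set of fillings of the Young diagram of $\lambda$ (English convention) by $1,\dots,n$, each used once, with rows increasing; $T^1$ (top row), $T^2$ are the rows of $T$, regarded as sets. Interchanging entries is followed by re-sorting rows. $\overline{\mathrm{des}}(T)=\{i\in[1,n]\mid i\text{ lies in a strictly higher row of }T\text{ than }\overline{i+1}\}$. $T,T'$ are connected by a Knuth move if $\overline{\mathrm{des}}(T),\overline{\mathrm{des}}(T')$ are incomparable under inclusion and $T'$ is obtained from $T$ by interchanging $\overline i$ and $\overline{i+1}$ for some $i$. **Labeled graphs.** A $[1,n]$-labeled graph is a triple $(V,m,\tau)$ with $m:V\times V\to\mathbb Z[q^{\pm1/2}]$ (written $m(u\triangleright v)$) and $\tau:V\to\{\text{subsets of }[1,n]\}$ (locally finite). Its simple underlying graph $U(\Gamma)$ has the same $V,\tau$, and weight $m'$ with $m'(u\triangleright v)=m'(v\triangleright u)=1$ if $m(u\triangleright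 v)=m(v\triangleright u)=1$, and $m'(u\triangleright v)=m'(v\triangleright u)=0$ otherwise. **The graph $\overline{\mathcal D}_\lambda$** (affine dual equivalence graph). Vertex set $\mathrm{RSYT}(\lambda)$, $\tau=\overline{\mathrm{des}}$, $m(u\triangleright v)=m(v\triangleright u)=1$ if $u,v$ are connected by a Knuth move, $0$ otherwise. **The graph $\overline\Gamma_\lambda$.** The $[1,n]$-labeled graph $(\mathrm{RSYT}(\lambda),m,\overline{\mathrm{des}})$ with $m\in\{0,1\}$ and $m(s\triangleright t)=1$ iff: (first kind) $t$ is obtained from $s$ by interchanging $\overline i\in s^1$ and $\overline{i+1}\in s^2$; or (second kind) $t$ is obtained from $s$ by interchanging $\overline i\in s^2$ and $\overline j\in s^1$, $\overline i\ne\overline{j+1}$, where $\overline{j-i}$ is odd; $\overline{i+1}\in s^1$ and $\overline{j-1}\in s^2$; $\overline{i-1}\in s^1$ or $\overline{j+1}\in s^2$; $\#(s^2\cap\langle\overline{j-1-2k},\overline{j-2}\rangle)\ge k$ for $k\in\{1,\dots,\frac{\overline{j-i}-3}2\}$; and $\#(s^2\cap\langle\overline{i+2},\overline{j-2}\rangle)=\frac{\overline{j-i}-3}2$ when $\overline j\neq\overline{i+1}$. -}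

module Defs where

open import Data.Bool.Base using (if_then_else_)
open import Data.Empty using (⊥-elim-irr)
open import Data.Fin.Base as Fin using (Fin; zero; suc; toℕ; fromℕ<)
open import Data.Fin.Permutation.Components using (transpose)
import Data.Fin.Properties as Fin
open import Data.Fin.Subset using (Subset; _∈_; _⊆_; _∩_; ∣_∣; ⊥)
open import Data.Fin.Subset.Properties using (_∈?_; _⊆?_)
open import Data.Integer.Base as ℤ using (ℤ; +_; 0ℤ; 1ℤ; _%ℕ_)
import Data.Integer.DivMod as ℤ
import Data.Integer.Properties as ℤ
open import Data.List.Base as List using (List; []; _∷_; concatMap; cartesianProductWith; allFin)
open import Data.List.Membership.Propositional using (lose) renaming (_∈_ to _∈ₗ_)
open import Data.List.Membership.Propositional.Properties using (∈-cartesianProductWith⁺; ∈-allFin; ∈-++⁺ˡ; ∈-++⁺ʳ)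
import Data.List.Relation.Unary.All as ListAll
import Data.List.Properties as List
open import Data.List.Relation.Unary.Any using (here; there)
import Data.List.Relation.Unary.Any as ListAny
import Data.List.Relation.Unary.Any.Properties as ListAny
open import Data.Nat.Base as ℕ using (ℕ; NonZero; _∸_; _/_; _%_; _≤_; _≥_)
import Data.Nat.Properties as ℕ
open import Data.Product using (Σ; ∃; ∃!; _×_; _,_; proj₁; proj₂)
open import Data.Product.Properties using (≡-dec)
open import Data.Sum.Base using (_⊎_; inj₁; [_,_]′)
open import Data.Vec.Base as Vec using (Vec; []; _∷_; tabulate; toList)
import Data.Vec.Membership.DecPropositional as VecMembership
open import Data.Vec.Relation.Unary.All as VecAll using ([]; _∷_)
open import Data.Vec.Relation.Unary.All.Properties using (lookup⁺)
open import Function.Base using (_∘_)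
open import Level using (0ℓ)
open import Relation.Binary.Core using (Rel)
open import Relation.Binary.Definitions using (DecidableEquality) renaming (Decidable to Decidable₂)
open import Relation.Binary.PropositionalEquality using (_≡_; _≢_; refl; sym; trans)
open import Relation.Nullary.Decidable using (Dec; yes; no; does; map′; recompute; ¬?; _×-dec_; _⊎-dec_; _→-dec_)
open import Relation.Nullary.Negation using (¬_; contradiction)
open import Relation.Unary using (Pred; Decidable)

-- [1,n] is represented by Fin n, with x : Fin n standing for the number
-- toℕ x + 1.

number : ∀ {n} → Fin n → ℕ
number x = ℕ.suc (toℕ x)

val : ∀ {n} → Fin n → ℤ
val x = + number x

-- bar k is the element of [1,n] congruent to k modulo n.

bar : ∀ {n} .{{_ : NonZero n}} → ℤ → Fin n
bar {n} k = fromℕ< (ℤ.n%ℕd<d (k ℤ.- 1ℤ) n)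

infixl 6 _⊕_ _⊖_

_⊕_ : ∀ {n} .{{_ : NonZero n}} → Fin n → ℕ → Fin n
a ⊕ k = bar (val a ℤ.+ + k)

_⊖_ : ∀ {n} .{{_ : NonZero n}} → Fin n → ℕ → Fin n
a ⊖ k = bar (val a ℤ.- + k)

⟦_⟧ : ∀ {n} {P : Pred (Fin n) 0ℓ} → Decidable P → Subset n
⟦ P? ⟧ = tabulate (does ∘ P?)

-- The number of steps x ↦ x ⊕ 1 leading from a to b, between 0 and n - 1.

steps : ∀ {n} .{{_ : NonZero n}} → Fin n → Fin n → ℕ
steps {n} a b = (val b ℤ.- val a) %ℕ n

⟨_,_⟩ : ∀ {n} .{{_ : NonZero n}} → Fin n → Fin n → Subset n
⟨ a , b ⟩ =
  if does (a Fin.≟ b ⊕ 1)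
  then ⊥
  else ⟦ (λ x → steps a x ℕ.≤? steps a b) ⟧

-- The shape is the vector of row lengths, the top row being row zero.

Cell : ∀ {r} → Vec ℕ r → Set
Cell {r} shape = Σ (Fin r) λ k → Fin (Vec.lookup shape k)

Filling : ∀ {r} → ℕ → Vec ℕ r → Set
Filling n = VecAll.All (Vec (Fin n))

module _ {r n : ℕ} {shape : Vec ℕ r} where

  rowOf : Filling n shape → (k : Fin r) → Vec (Fin n) (Vec.lookup shape k)
  rowOf = lookup⁺

  entry : Filling n shape → Cell shape → Fin n
  entry f (k , c) = Vec.lookup (rowOf f k) c

  RowsIncreasing : Filling n shape → Set
  RowsIncreasing f = ∀ k c c′ → c Fin.< c′ → entry f (k , c) Fin.< entry f (k , c′)

  EachUsedOnce : Filling n shape → Set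
  EachUsedOnce f = ∀ x → ∃! _≡_ λ cell → entry f cell ≡ x

  IsRowStandard : Filling n shape → Set
  IsRowStandard f = RowsIncreasing f × EachUsedOnce f

  private
    _≟ᶜ_ : DecidableEquality (Cell shape)
    _≟ᶜ_ = ≡-dec Fin._≟_ Fin._≟_

    anyCell? : ∀ {P : Pred (Cell shape) 0ℓ} → Decidable P → Dec (∃ P)
    anyCell? P? = map′ (λ (k , c , p) → (k , c) , p) (λ ((k , c) , p) → k , c , p)
      (Fin.any? λ k → Fin.any? λ c → P? (k , c))

    allCells? : ∀ {P : Pred (Cell shape) 0ℓ} → Decidable P → Dec (∀ {x} → P x)
    allCells? P? = map′ (λ h {(k , c)} → h k c) (λ h k c → h {k , c})
      (Fin.all? λ k → Fin.all? λ c → P? (k , c))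

  isRowStandard? : Decidable IsRowStandard
  isRowStandard? f =
    (Fin.all? λ k → Fin.all? λ c → Fin.all? λ c′ →
      (c Fin.<? c′) →-dec (entry f (k , c) Fin.<? entry f (k , c′)))
    ×-dec
    (Fin.all? λ x → anyCell? λ cell →
      (entry f cell Fin.≟ x) ×-dec
      allCells? λ cell′ → (entry f cell′ Fin.≟ x) →-dec (cell ≟ᶜ cell′))

-- The proof is irrelevant so that tableaux with the same filling are
-- propositionally equal.

record RSYT {r : ℕ} (n : ℕ) (shape : Vec ℕ r) : Set where
  constructor tableau
  field
    filling      : Filling n shape
    .rowStandard : IsRowStandard filling

  row : (k : Fin r) → List (Fin n)
  row k = toList (rowOf filling k)

  rowSet : Fin r → Subset n
  rowSet k = ⟦ (λ x → x ∈ᵛ? rowOf filling k) ⟧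
    where open VecMembership Fin._≟_ using () renaming (_∈?_ to _∈ᵛ?_)

open RSYT public

isRowStandard : ∀ {r n} {shape : Vec ℕ r} (T : RSYT n shape) → IsRowStandard (filling T)
isRowStandard (tableau f p) = recompute (isRowStandard? f) p

Finite : Set → Set
Finite A = ∃ λ (xs : List A) → ∀ x → x ∈ₗ xs

private
  vec-finite : ∀ n k → Finite (Vec (Fin n) k)
  vec-finite n ℕ.zero = [] ∷ [] , λ { [] → here refl }
  vec-finite n (ℕ.suc k) =
    let vs , complete = vec-finite n k
    in cartesianProductWith _∷_ (allFin n) vs ,
       λ { (x ∷ v) → ∈-cartesianProductWith⁺ _∷_ (∈-allFin x) (complete v) }

  filling-finite : ∀ {r} n (shape : Vec ℕ r) → Finite (Filling n shape)
  filling-finite n [] = [] ∷ [] , λ { [] → here refl }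
  filling-finite n (k ∷ shape) =
    let vs , complete₁ = vec-finite n k
        fs , complete₂ = filling-finite n shape
    in cartesianProductWith _∷_ vs fs ,
       λ { (v ∷ f) → ∈-cartesianProductWith⁺ _∷_ (complete₁ v) (complete₂ f) }

RSYT-finite : ∀ {r} n (shape : Vec ℕ r) → Finite (RSYT n shape)
RSYT-finite n shape = concatMap tableaux fs , λ T →
    ListAny.concatMap⁺ tableaux (lose (complete (filling T)) (∈-tableaux T))
  where
  fs = proj₁ (filling-finite n shape)
  complete = proj₂ (filling-finite n shape)

  tableaux : Filling n shape → List (RSYT n shape)
  tableaux f with isRowStandard? f
  ... | yes p = tableau f p ∷ []
  ... | no  _ = []

  ∈-tableaux : ∀ T → T ∈ₗ tableaux (filling T)
  ∈-tableaux (tableau f p) with isRowStandard? f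
  ... | yes _  = here refl
  ... | no  ¬p = ⊥-elim-irr (¬p p)

module _ {n : ℕ} where
  open import Data.List.Sort (Fin.≤-decTotalOrder n) public using (sort; sort-↭; sort-↗)

-- Interchanged S T a b: T is obtained from S by interchanging the entries
-- a and b and then re-sorting the rows.

Interchanged : ∀ {r n} {shape : Vec ℕ r} → RSYT n shape → RSYT n shape → Fin n → Fin n → Set
Interchanged S T a b = ∀ k → row T k ≡ sort (List.map (transpose a b) (row S k))

interchanged? : ∀ {r n} {shape : Vec ℕ r} (S T : RSYT n shape) (a b : Fin n) →
                Dec (Interchanged S T a b)
interchanged? S T a b = Fin.all? λ k → List.≡-dec Fin._≟_ _ _

module _ {r n : ℕ} .{{_ : NonZero n}} {shape : Vec ℕ r} where

  IsDescent : RSYT n shape → Fin n → Set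
  IsDescent T i = ∃ λ k → ∃ λ k′ → k Fin.< k′ × i ∈ rowSet T k × i ⊕ 1 ∈ rowSet T k′

  isDescent? : ∀ T → Decidable (IsDescent T)
  isDescent? T i = Fin.any? λ k → Fin.any? λ k′ →
    (k Fin.<? k′) ×-dec (i ∈? rowSet T k) ×-dec (i ⊕ 1 ∈? rowSet T k′)

  des : RSYT n shape → Subset n
  des T = ⟦ isDescent? T ⟧

  KnuthMove : Rel (RSYT n shape) 0ℓ
  KnuthMove S T =
    ¬ (des S ⊆ des T) × ¬ (des T ⊆ des S) × ∃ λ i → Interchanged S T i (i ⊕ 1)

  knuthMove? : Decidable₂ KnuthMove
  knuthMove? S T =
    ¬? (des S ⊆? des T) ×-dec ¬? (des T ⊆? des S) ×-dec
    Fin.any? λ i → interchanged? S T i (i ⊕ 1)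

-- A Laurent polynomial is a formal sum of terms, the pair (a , e) standing
-- for a q^{e/2}. Exponents may repeat and coefficients may vanish, so
-- equality of polynomials is _≈_, not _≡_.

Laurent : Set
Laurent = List (ℤ × ℤ)

coeff : Laurent → ℤ → ℤ
coeff []            k = 0ℤ
coeff ((a , e) ∷ p) k = if does (e ℤ.≟ k) then a ℤ.+ coeff p k else coeff p k

infix 4 _≈_ _≉_ _≈?_

_≈_ : Rel Laurent 0ℓ
p ≈ q = ∀ k → coeff p k ≡ coeff q k

_≉_ : Rel Laurent 0ℓ
p ≉ q = ¬ (p ≈ q)

0ᴸ 1ᴸ : Laurent
0ᴸ = []
1ᴸ = (1ℤ , 0ℤ) ∷ []

private
  exponents : Laurent → List ℤ
  exponents = List.map proj₂

  coeff-∉ : ∀ p {k} → ¬ (k ∈ₗ exponents p) → coeff p k ≡ 0ℤ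
  coeff-∉ []            _  = refl
  coeff-∉ ((a , e) ∷ p) {k} k∉ with e ℤ.≟ k
  ... | yes refl = contradiction (here refl) k∉
  ... | no  _    = coeff-∉ p (k∉ ∘ there)

_≈?_ : Decidable₂ _≈_
p ≈? q = map′ everywhere (λ h → ListAll.tabulate λ {k} _ → h k)
  (ListAll.all? (λ k → coeff p k ℤ.≟ coeff q k) (exponents p List.++ exponents q))
  where
  everywhere : ListAll.All (λ k → coeff p k ≡ coeff q k) (exponents p List.++ exponents q) → p ≈ q
  everywhere h k with ListAny.any? (k ℤ.≟_) (exponents p List.++ exponents q)
  ... | yes k∈ = ListAll.lookup h k∈
  ... | no  k∉ = trans (coeff-∉ p (k∉ ∘ ∈-++⁺ˡ)) (sym (coeff-∉ q (k∉ ∘ ∈-++⁺ʳ (exponents p))))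

indicator : ∀ {P : Set} → Dec P → Laurent
indicator P? = if does P? then 1ᴸ else 0ᴸ

indicator≉0⇒ : ∀ {P : Set} (P? : Dec P) → indicator P? ≉ 0ᴸ → P
indicator≉0⇒ (yes p) _       = p
indicator≉0⇒ (no _)  nonzero = contradiction (λ _ → refl) nonzero

≈1⇒≉0 : ∀ p → p ≈ 1ᴸ → p ≉ 0ᴸ
≈1⇒≉0 p p≈1 p≈0 with trans (sym (p≈1 0ℤ)) (p≈0 0ℤ)
... | ()

-- m u v is the weight m(u ▷ v). Local finiteness says that each vertex is
-- incident to finitely many edges of nonzero weight.

record LabeledGraph (n : ℕ) (V : Set) : Set where
  field
    m             : V → V → Laurent
    τ             : V → Subset n
    locallyFinite : ∀ u → ∃ λ (vs : List V) → ∀ v → m u v ≉ 0ᴸ ⊎ m v u ≉ 0ᴸ → v ∈ₗ vs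

open LabeledGraph public

infix 4 _≈ᴳ_

_≈ᴳ_ : ∀ {n V} → Rel (LabeledGraph n V) 0ℓ
Γ ≈ᴳ Γ′ = (∀ u v → m Γ u v ≈ m Γ′ u v) × (∀ u → τ Γ u ≡ τ Γ′ u)

finiteGraph : ∀ {n V} → Finite V → (V → V → Laurent) → (V → Subset n) → LabeledGraph n V
finiteGraph (vs , complete) m τ = record
  { m             = m
  ; τ             = τ
  ; locallyFinite = λ _ → vs , λ v _ → complete v
  }

simple? : ∀ {n V} (Γ : LabeledGraph n V) (u v : V) → Dec (m Γ u v ≈ 1ᴸ × m Γ v u ≈ 1ᴸ)
simple? Γ u v = (m Γ u v ≈? 1ᴸ) ×-dec (m Γ v u ≈? 1ᴸ)

U : ∀ {n V} → LabeledGraph n V → LabeledGraph n V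
U Γ = record
  { m             = λ u v → indicator (simple? Γ u v)
  ; τ             = τ Γ
  ; locallyFinite = λ u → proj₁ (locallyFinite Γ u) , λ v nonzero →
      proj₂ (locallyFinite Γ u) v (inj₁ (≈1⇒≉0 (m Γ u v) (
        [ proj₁ ∘ indicator≉0⇒ (simple? Γ u v)
        , proj₂ ∘ indicator≉0⇒ (simple? Γ v u)
        ]′ nonzero)))
  }

D-bar : ∀ {r n} .{{_ : NonZero n}} (shape : Vec ℕ r) → LabeledGraph n (RSYT n shape)
D-bar {n = n} shape =
  finiteGraph (RSYT-finite n shape) (λ u v → indicator (knuthMove? u v)) des

module _ {n : ℕ} .{{_ : NonZero n}} {λ₁ λ₂ : ℕ} where

  private
    Tableau : Set
    Tableau = RSYT n (λ₁ ∷ λ₂ ∷ [])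

  infix 9 _¹ _²

  _¹ _² : Tableau → Subset n
  s ¹ = rowSet s zero
  s ² = rowSet s (suc zero)

  FirstKind : Rel Tableau 0ℓ
  FirstKind s t = ∃ λ i → i ∈ s ¹ × i ⊕ 1 ∈ s ² × Interchanged s t i (i ⊕ 1)

  distance : Fin n → Fin n → ℕ
  distance i j = number (bar {n} (val j ℤ.- val i))

  -- Used only for odd distances, where the division by 2 is exact. When
  -- the distance is 1 (that is, j = i ⊕ 1) the truncated value 0 replaces -1;
  -- it then only bounds the range 1 ≤ k ≤ half i j, which is empty either way.

  half : Fin n → Fin n → ℕ
  half i j = (distance i j ∸ 3) / 2

  Ballot : Tableau → Fin n → Fin n → Set
  Ballot s i j = ∀ k → 1 ≤ k → k ≤ half i j →
    ∣ s ² ∩ ⟨ j ⊖ (1 ℕ.+ 2 ℕ.* k) , j ⊖ 2 ⟩ ∣ ≥ k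

  SecondKindAt : Tableau → Tableau → Fin n → Fin n → Set
  SecondKindAt s t i j =
    i ∈ s ² ×
    j ∈ s ¹ ×
    Interchanged s t i j ×
    i ≢ j ⊕ 1 ×
    distance i j % 2 ≡ 1 ×
    i ⊕ 1 ∈ s ¹ ×
    j ⊖ 1 ∈ s ² ×
    (i ⊖ 1 ∈ s ¹ ⊎ j ⊕ 1 ∈ s ²) ×
    Ballot s i j ×
    (j ≢ i ⊕ 1 → ∣ s ² ∩ ⟨ i ⊕ 2 , j ⊖ 2 ⟩ ∣ ≡ half i j)

  SecondKind : Rel Tableau 0ℓ
  SecondKind s t = ∃ λ i → ∃ λ j → SecondKindAt s t i j

  ballot? : ∀ s i j → Dec (Ballot s i j)
  ballot? s i j = map′
    (λ h k 1≤k k≤half → h (ℕ.s≤s k≤half) 1≤k)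
    (λ h {k} k<1+half 1≤k → h k 1≤k (ℕ.s≤s⁻¹ k<1+half))
    (ℕ.allUpTo? (λ k → (1 ℕ.≤? k) →-dec (k ℕ.≤? _)) (ℕ.suc (half i j)))

  edge? : Decidable₂ (λ s t → FirstKind s t ⊎ SecondKind s t)
  edge? s t =
    (Fin.any? λ i →
      (i ∈? s ¹) ×-dec (i ⊕ 1 ∈? s ²) ×-dec interchanged? s t i (i ⊕ 1))
    ⊎-dec
    (Fin.any? λ i → Fin.any? λ j →
      (i ∈? s ²) ×-dec
      (j ∈? s ¹) ×-dec
      interchanged? s t i j ×-dec
      ¬? (i Fin.≟ j ⊕ 1) ×-dec
      (distance i j % 2 ℕ.≟ 1) ×-dec
      (i ⊕ 1 ∈? s ¹) ×-dec
      (j ⊖ 1 ∈? s ²) ×-dec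
      ((i ⊖ 1 ∈? s ¹) ⊎-dec (j ⊕ 1 ∈? s ²)) ×-dec
      ballot? s i j ×-dec
      (¬? (j Fin.≟ i ⊕ 1) →-dec (∣ s ² ∩ ⟨ i ⊕ 2 , j ⊖ 2 ⟩ ∣ ℕ.≟ half i j)))

Γ-bar : ∀ {n} .{{_ : NonZero n}} (λ₁ λ₂ : ℕ) → LabeledGraph n (RSYT n (λ₁ ∷ λ₂ ∷ []))
Γ-bar {n} λ₁ λ₂ =
  finiteGraph (RSYT-finite n (λ₁ ∷ λ₂ ∷ [])) (λ s t → indicator (edge? s t)) des

{-# OPTIONS --safe #-}

-- An edge of Γ̄ interchanges an entry of the top row with one of the bottom
-- row, and an edge back must interchange the same two entries. Hence two
-- edges of the first kind cannot be opposite (this would force i + 2 ≡ i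
-- modulo n), and neither can two edges of the second kind between i and j:
-- one of them requires i - 1 in the top row or j + 1 in the bottom row, the
-- other one j + 1 in the top row and i - 1 in the bottom row, and these two
-- entries do not move. An edge of the first kind at i is opposed by one of
-- the second kind exactly when i - 1 is in the top row or i + 2 in the bottom
-- row, which is also the condition for the descent sets to be incomparable.

module Submission where

open import Defs
open import Algebra.Bundles using (AbelianGroup)
open import Algebra.Properties.AbelianGroup using (xyx⁻¹≈y)
open import Algebra.Properties.Group using (//-rightDividesʳ)
open import Data.Bool.Base using (if_then_else_)
open import Data.Empty using (⊥-elim)
open import Data.Fin.Base as Fin using (Fin; zero; suc; toℕ)
open import Data.Fin.Permutation.Components using (transpose; transpose-inverse)
import Data.Fin.Properties as Fin
open import Data.Fin.Subset using (_∈_; _⊆_)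
open import Data.Integer.Base as ℤ using (+_; 1ℤ; _%ℕ_)
import Data.Integer.Properties as ℤ
import Data.List.Base as List
import Data.List.Properties as List
open import Data.List.Membership.Propositional.Properties using (∈-map⁺)
open import Data.List.Relation.Binary.Equality.Propositional using (≋⇒≡)
open import Data.List.Relation.Binary.Permutation.Propositional
  using (_↭_; ↭-sym; ↭-trans; ↭-reflexive; ↭⇒↭ₛ; module PermutationReasoning)
open import Data.List.Relation.Binary.Permutation.Propositional.Properties using (map⁺; ∈-resp-↭)
open import Data.List.Relation.Unary.AllPairs using (AllPairs; []; _∷_)
open import Data.List.Relation.Unary.Sorted.TotalOrder using (Sorted)
open import Data.List.Relation.Unary.Sorted.TotalOrder.Properties using (AllPairs⇒Sorted; ↗↭↗⇒≋)
open import Data.Nat.Base as ℕ using (ℕ; NonZero; _+_; _∸_; _%_; _≥_)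
import Data.Nat.DivMod as ℕ
import Data.Nat.Properties as ℕ
open import Data.Product using (∃; _×_; _,_; proj₁; proj₂)
open import Data.Sum.Base using (_⊎_; inj₁; inj₂)
open import Data.Vec.Base as Vec using (Vec; []; _∷_)
import Data.Vec.Membership.DecPropositional as DecMembership
import Data.Vec.Membership.Propositional as Vec
import Data.Vec.Membership.Propositional.Properties as Vec
import Data.Vec.Properties as Vec
import Data.Vec.Relation.Unary.All.Properties as VecAll
import Data.Vec.Relation.Unary.Any as VecAny
import Data.Vec.Relation.Unary.Any.Properties as VecAny
open import Function.Base using (_∘_; id; case_of_)
open import Function.Bundles using (_⇔_; mk⇔)
open import Level using (0ℓ)
open import Relation.Binary.Core using (Rel)
open import Relation.Binary.PropositionalEquality
open import Relation.Nullary.Decidable using (Dec; yes; no; does; dec-true; dec-false; does-⇔)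
open import Relation.Nullary.Negation using (¬_; contradiction)
open import Relation.Unary using (Pred; Decidable)

-- Subsets given by decidable predicates.

∈⟦⟧⁺ : ∀ {n} {P : Pred (Fin n) 0ℓ} (P? : Decidable P) {x} → P x → x ∈ ⟦ P? ⟧
∈⟦⟧⁺ P? {x} px = Vec.lookup⇒[]= x _
  (trans (Vec.lookup∘tabulate (does ∘ P?) x) (dec-true (P? x) px))

∈⟦⟧⁻ : ∀ {n} {P : Pred (Fin n) 0ℓ} (P? : Decidable P) {x} → x ∈ ⟦ P? ⟧ → P x
∈⟦⟧⁻ P? {x} x∈ with P? x | trans (sym (Vec.lookup∘tabulate (does ∘ P?) x)) (Vec.[]=⇒lookup x∈)
... | yes px | _ = px

-- Cyclic successors and predecessors

module _ {n : ℕ} .{{_ : NonZero n}} where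

  toℕ-bar : ∀ k → toℕ (bar {n} k) ≡ (k ℤ.- 1ℤ) %ℕ n
  toℕ-bar k = Fin.toℕ-fromℕ< _

  toℕ-⊕ : (a : Fin n) (k : ℕ) → toℕ (a ⊕ k) ≡ (toℕ a + k) % n
  toℕ-⊕ a k = toℕ-bar (val a ℤ.+ + k)

  ⊕-1-cases : (a : Fin n) →
    toℕ (a ⊕ 1) ≡ ℕ.suc (toℕ a) ⊎ toℕ (a ⊕ 1) ≡ 0 × ℕ.suc (toℕ a) ≡ n
  ⊕-1-cases a with ℕ.m≤n⇒m<n∨m≡n (Fin.toℕ<n a)
  ... | inj₁ 1+a<n = inj₁ (begin
    toℕ (a ⊕ 1)        ≡⟨ toℕ-⊕ a 1 ⟩
    (toℕ a + 1) % n    ≡⟨ cong (_% n) (ℕ.+-comm (toℕ a) 1) ⟩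
    ℕ.suc (toℕ a) % n  ≡⟨ ℕ.m<n⇒m%n≡m 1+a<n ⟩
    ℕ.suc (toℕ a)      ∎)
    where open ≡-Reasoning
  ... | inj₂ 1+a≡n = inj₂ ((begin
    toℕ (a ⊕ 1)        ≡⟨ toℕ-⊕ a 1 ⟩
    (toℕ a + 1) % n    ≡⟨ cong (_% n) (trans (ℕ.+-comm (toℕ a) 1) 1+a≡n) ⟩
    n % n              ≡⟨ ℕ.n%n≡0 n ⟩
    0                  ∎) , 1+a≡n)
    where open ≡-Reasoning

  ⊕-1-injective : {a b : Fin n} → a ⊕ 1 ≡ b ⊕ 1 → a ≡ b
  ⊕-1-injective {a} {b} eq with ⊕-1-cases a | ⊕-1-cases b
  ... | inj₁ p       | inj₁ q       =
    Fin.toℕ-injective (ℕ.suc-injective (trans (sym p) (trans (cong toℕ eq) q)))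
  ... | inj₁ p       | inj₂ (q , _) with trans (sym p) (trans (cong toℕ eq) q)
  ...   | ()
  ⊕-1-injective {a} {b} eq | inj₂ (p , _) | inj₁ q with trans (sym q) (trans (cong toℕ (sym eq)) p)
  ...   | ()
  ⊕-1-injective {a} {b} eq | inj₂ (_ , p) | inj₂ (_ , q) =
    Fin.toℕ-injective (ℕ.suc-injective (trans p (sym q)))

  ⊕-1≢ : n ≥ 2 → (a : Fin n) → a ⊕ 1 ≢ a
  ⊕-1≢ n≥2 a eq with ⊕-1-cases a
  ... | inj₁ p       = ℕ.1+n≢n (trans (sym p) (cong toℕ eq))
  ... | inj₂ (p , q) = ℕ.<-irrefl (trans (cong ℕ.suc (trans (sym p) (cong toℕ eq))) q) n≥2

  -- Without wrap-around `a` would equal `a + 2`; one wrap forces `n = 2`, and two force `n = 1`.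
  ⊕-1⊕-1≢ : n ≥ 3 → (a : Fin n) → a ⊕ 1 ⊕ 1 ≢ a
  ⊕-1⊕-1≢ n≥3 a eq with ⊕-1-cases a | ⊕-1-cases (a ⊕ 1)
  ... | inj₁ p       | inj₁ q       =
    ℕ.m≢1+n+m (toℕ a) {1} (trans (sym (cong toℕ eq)) (trans q (cong ℕ.suc p)))
  ... | inj₁ p       | inj₂ (q , r) = ℕ.<-irrefl
    (trans (cong (ℕ.suc ∘ ℕ.suc) (trans (sym q) (cong toℕ eq))) (trans (cong ℕ.suc (sym p)) r)) n≥3
  ... | inj₂ (p , r) | inj₁ q       = ℕ.<-irrefl
    (trans (cong ℕ.suc (trans (cong ℕ.suc (sym p)) (trans (sym q) (cong toℕ eq)))) r) n≥3
  ... | inj₂ (p , r) | inj₂ (q , r′) = ℕ.<-irrefl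
    (trans (cong ℕ.suc (sym p)) r′) (ℕ.≤-trans (ℕ.s≤s (ℕ.s≤s ℕ.z≤n)) n≥3)

⊖-1-⊕-1 : ∀ {n} .{{_ : NonZero n}} (a : Fin n) → a ⊖ 1 ⊕ 1 ≡ a
-- For `n ≥ 2` the remainder of `-1` computes to `n - 1`; for `n = 1` there is only one element.
⊖-1-⊕-1 {1} a with a ⊖ 1 ⊕ 1
⊖-1-⊕-1 {1} zero | zero = refl
⊖-1-⊕-1 {n@(ℕ.suc (ℕ.suc m))} zero = Fin.toℕ-injective (begin
  toℕ (zero ⊖ 1 ⊕ 1)          ≡⟨ toℕ-⊕ (zero ⊖ 1) 1 ⟩
  (toℕ {n} (zero ⊖ 1) + 1) % n ≡⟨ cong (λ x → (x + 1) % n) (toℕ-bar (val {n} zero ℤ.- + 1)) ⟩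
  (ℕ.suc m + 1) % n           ≡⟨ cong (_% n) (ℕ.+-comm (ℕ.suc m) 1) ⟩
  n % n                       ≡⟨ ℕ.n%n≡0 n ⟩
  0                           ∎)
  where open ≡-Reasoning
⊖-1-⊕-1 {n@(ℕ.suc (ℕ.suc m))} (suc a) = Fin.toℕ-injective (begin
  toℕ (suc a ⊖ 1 ⊕ 1)          ≡⟨ toℕ-⊕ (suc a ⊖ 1) 1 ⟩
  (toℕ (suc a ⊖ 1) + 1) % n    ≡⟨ cong (λ x → (x + 1) % n) (toℕ-bar (val (suc a) ℤ.- + 1)) ⟩
  (toℕ a % n + 1) % n          ≡⟨ cong (λ x → (x + 1) % n) (ℕ.m<n⇒m%n≡m (ℕ.m<n⇒m<1+n (Fin.toℕ<n a))) ⟩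
  (toℕ a + 1) % n              ≡⟨ cong (_% n) (ℕ.+-comm (toℕ a) 1) ⟩
  ℕ.suc (toℕ a) % n            ≡⟨ ℕ.m<n⇒m%n≡m (Fin.toℕ<n (suc a)) ⟩
  ℕ.suc (toℕ a)                ∎)
  where open ≡-Reasoning

-- Injectivity of `_⊕ 1` reduces this to the other inverse law, taken at `a ⊕ 1`.
⊕-1-⊖-1 : ∀ {n} .{{_ : NonZero n}} (a : Fin n) → a ⊕ 1 ⊖ 1 ≡ a
⊕-1-⊖-1 a = ⊕-1-injective (⊖-1-⊕-1 (a ⊕ 1))

-- Distance between cyclic neighbours.

-n%ℕn≡0 : ∀ n .{{_ : NonZero n}} → (ℤ.- + n) %ℕ n ≡ 0
-n%ℕn≡0 n@(ℕ.suc m) rewrite ℕ.n%n≡0 n {{_}} = refl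

module _ {n : ℕ} .{{_ : NonZero n}} {λ₁ λ₂ : ℕ} where

  -- Makes the oddness and ballot conditions of `SecondKindAt` automatic for `j = i ⊕ 1`. If `a ⊕ 1`
  -- wraps, the values differ by `1 - n`, and the shift by one in `bar` leaves `-n`, whose remainder
  -- is 0.
  distance-⊕-1 : (a : Fin n) → distance {λ₁ = λ₁} {λ₂} a (a ⊕ 1) ≡ 1
  distance-⊕-1 a with ⊕-1-cases a
  ... | inj₁ p = cong ℕ.suc (begin
    toℕ (bar {n} (val (a ⊕ 1) ℤ.- val a))        ≡⟨ toℕ-bar (val (a ⊕ 1) ℤ.- val a) ⟩
    (val (a ⊕ 1) ℤ.- val a ℤ.- 1ℤ) %ℕ n           ≡⟨ cong (λ x → (+ ℕ.suc x ℤ.- val a ℤ.- 1ℤ) %ℕ n) p ⟩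
    (1ℤ ℤ.+ val a ℤ.- val a ℤ.- 1ℤ) %ℕ n          ≡⟨ cong (λ x → (x ℤ.- 1ℤ) %ℕ n)
      (//-rightDividesʳ (AbelianGroup.group ℤ.+-0-abelianGroup) (val a) 1ℤ) ⟩
    0 % n                                         ≡⟨ ℕ.m*n%n≡0 0 n ⟩
    0                                             ∎)
    where open ≡-Reasoning
  ... | inj₂ (p , q) = cong ℕ.suc (begin
    toℕ (bar {n} (val (a ⊕ 1) ℤ.- val a))        ≡⟨ toℕ-bar (val (a ⊕ 1) ℤ.- val a) ⟩
    (val (a ⊕ 1) ℤ.- val a ℤ.- 1ℤ) %ℕ n           ≡⟨ cong₂ (λ x y → (+ ℕ.suc x ℤ.- + y ℤ.- 1ℤ) %ℕ n) p q ⟩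
    (1ℤ ℤ.- + n ℤ.- 1ℤ) %ℕ n                      ≡⟨ cong (_%ℕ n) (xyx⁻¹≈y ℤ.+-0-abelianGroup 1ℤ (ℤ.- + n)) ⟩
    (ℤ.- + n) %ℕ n                                ≡⟨ -n%ℕn≡0 n ⟩
    0                                             ∎)
    where open ≡-Reasoning

  half-⊕-1 : (a : Fin n) → half {λ₁ = λ₁} {λ₂} a (a ⊕ 1) ≡ 0
  half-⊕-1 a = cong (λ d → (d ∸ 3) ℕ./ 2) (distance-⊕-1 a)

AllPairs-toList⁺ : ∀ {A : Set} {R : Rel A 0ℓ} {n} (xs : Vec A n) →
  (∀ i j → i Fin.< j → R (Vec.lookup xs i) (Vec.lookup xs j)) → AllPairs R (Vec.toList xs)
AllPairs-toList⁺ []       mono = []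
AllPairs-toList⁺ (x ∷ xs) mono =
  VecAll.toList⁺ (VecAll.lookup⁻ λ j → mono zero (suc j) (ℕ.s≤s ℕ.z≤n)) ∷
  AllPairs-toList⁺ xs (λ i j i<j → mono (suc i) (suc j) (ℕ.s≤s i<j))

-- Tableaux as partitions of [1,n] into rows

module _ {r n : ℕ} {shape : Vec ℕ r} where
  open DecMembership (Fin._≟_ {n}) using () renaming (_∈?_ to _∈ᵛ?_)

  ∈-rowSet⁺ : (T : RSYT n shape) {k : Fin r} {x : Fin n} →
    x Vec.∈ rowOf (filling T) k → x ∈ rowSet T k
  ∈-rowSet⁺ T {k} = ∈⟦⟧⁺ (_∈ᵛ? rowOf (filling T) k)

  ∈-rowSet⁻ : (T : RSYT n shape) {k : Fin r} {x : Fin n} →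
    x ∈ rowSet T k → x Vec.∈ rowOf (filling T) k
  ∈-rowSet⁻ T {k} = ∈⟦⟧⁻ (_∈ᵛ? rowOf (filling T) k)

  ∈-someRow : (T : RSYT n shape) (x : Fin n) → ∃ λ k → x ∈ rowSet T k
  ∈-someRow T x with proj₂ (isRowStandard T) x
  ... | (k , c) , refl , _ = k , ∈-rowSet⁺ T (Vec.∈-lookup c (rowOf (filling T) k))

  -- Both rows agree with the row of the one cell that `EachUsedOnce` provides for `x`.
  ∈-uniqueRow : (T : RSYT n shape) {k l : Fin r} {x : Fin n} →
    x ∈ rowSet T k → x ∈ rowSet T l → k ≡ l
  ∈-uniqueRow T {x = x} x∈k x∈l =
    trans (sym (k≡ (∈-rowSet⁻ T x∈k))) (k≡ (∈-rowSet⁻ T x∈l))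
    where
    k≡ : ∀ {m} → x Vec.∈ rowOf (filling T) m → proj₁ (proj₁ (proj₂ (isRowStandard T) x)) ≡ m
    k≡ {m} x∈m = cong proj₁
      (proj₂ (proj₂ (proj₂ (isRowStandard T) x)) {m , VecAny.index x∈m} (sym (VecAny.lookup-index x∈m)))

  -- Sortedness makes a row recoverable from its entries up to permutation, as `interchanged-sym`
  -- requires.
  row-sorted : (T : RSYT n shape) (k : Fin r) → Sorted (Fin.≤-totalOrder n) (row T k)
  row-sorted T k = AllPairs⇒Sorted (Fin.≤-totalOrder n)
    (AllPairs-toList⁺ (rowOf (filling T) k) λ i j i<j → ℕ.<⇒≤ (proj₁ (isRowStandard T) k i j i<j))

-- Interchanging entries of tableaux.

transpose-comm : ∀ {n} (a b : Fin n) → transpose a b ≗ transpose b a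
transpose-comm a b x with x Fin.≟ a | x Fin.≟ b
... | yes refl | yes refl = refl
... | yes refl | no  _    rewrite dec-true (a Fin.≟ a) refl = refl
... | no  _    | yes refl rewrite dec-true (b Fin.≟ b) refl = refl
... | no  x≢a  | no  x≢b  rewrite dec-false (x Fin.≟ a) x≢a | dec-false (x Fin.≟ b) x≢b = refl

transpose-involutive : ∀ {n} (a b : Fin n) → transpose a b ∘ transpose a b ≗ id
transpose-involutive a b x =
  trans (cong (transpose a b) (transpose-comm a b x)) (transpose-inverse a b)

transposeˡ : ∀ {n} (a b : Fin n) → transpose a b a ≡ b
transposeˡ a b rewrite dec-true (a Fin.≟ a) refl = refl

transpose-fixed : ∀ {n} {a b x : Fin n} → x ≢ a → x ≢ b → transpose a b x ≡ x
transpose-fixed {a = a} {b} {x} x≢a x≢b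
  rewrite dec-false (x Fin.≟ a) x≢a | dec-false (x Fin.≟ b) x≢b = refl

module _ {r n : ℕ} {shape : Vec ℕ r} (S T : RSYT n shape) where

  interchanged-↭ : ∀ {a b} → Interchanged S T a b → ∀ k →
    row T k ↭ List.map (transpose a b) (row S k)
  interchanged-↭ S↔T k = ↭-trans (↭-reflexive (S↔T k)) (sort-↭ _)

  interchanged-comm : ∀ {a b} → Interchanged S T a b → Interchanged S T b a
  interchanged-comm {a} {b} S↔T k =
    trans (S↔T k) (cong sort (List.map-cong (transpose-comm a b) (row S k)))

  interchanged-∈ : ∀ {a b k x} → Interchanged S T a b →
    x ∈ rowSet S k → transpose a b x ∈ rowSet T k
  interchanged-∈ {a} {b} {k} S↔T x∈ = ∈-rowSet⁺ T (Vec.∈-toList⁻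
    (∈-resp-↭ (↭-sym (interchanged-↭ S↔T k)) (∈-map⁺ (transpose a b) (Vec.∈-toList⁺ (∈-rowSet⁻ S x∈)))))

  interchanged-∈-fixed : ∀ {a b k x} → Interchanged S T a b → x ≢ a → x ≢ b →
    x ∈ rowSet S k → x ∈ rowSet T k
  interchanged-∈-fixed {k = k} S↔T x≢a x≢b x∈ =
    subst (_∈ rowSet T k) (transpose-fixed x≢a x≢b) (interchanged-∈ S↔T x∈)

  interchanged-∈ˡ : ∀ {a b k} → Interchanged S T a b → a ∈ rowSet S k → b ∈ rowSet T k
  interchanged-∈ˡ {a} {b} {k} S↔T a∈ = subst (_∈ rowSet T k) (transposeˡ a b) (interchanged-∈ S↔T a∈)

-- Transposing twice is the identity, so re-sorting the transposed row of `T` gives a permutation of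
-- the row of `S`. Both lists are sorted, hence equal.
interchanged-sym : ∀ {r n} {shape : Vec ℕ r} (S T : RSYT n shape) {a b} →
  Interchanged S T a b → Interchanged T S a b
interchanged-sym {n = n} S T {a} {b} S↔T k = ≋⇒≡ (↗↭↗⇒≋ (Fin.≤-totalOrder n)
  (row-sorted S k) (sort-↗ _) (↭⇒↭ₛ (↭-sym (begin
    sort (List.map σ (row T k))           ↭⟨ sort-↭ _ ⟩
    List.map σ (row T k)                  ↭⟨ map⁺ σ (interchanged-↭ S T S↔T k) ⟩
    List.map σ (List.map σ (row S k))     ≡⟨ List.map-∘ (row S k) ⟨
    List.map (σ ∘ σ) (row S k)            ≡⟨ List.map-cong (transpose-involutive a b) (row S k) ⟩
    List.map id (row S k)                 ≡⟨ List.map-id (row S k) ⟩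
    row S k                               ∎))))
  where
  open PermutationReasoning
  σ = transpose a b

interchanged-∈ʳ : ∀ {r n} {shape : Vec ℕ r} (S T : RSYT n shape) {a b k} →
  Interchanged S T a b → b ∈ rowSet S k → a ∈ rowSet T k
interchanged-∈ʳ S T S↔T = interchanged-∈ˡ S T (interchanged-comm S T S↔T)

-- Swapping two entries of one row moves nothing to another row. A Knuth move therefore needs `i`
-- and `i ⊕ 1` in different rows.
interchanged-sameRow⇒des⊆ : ∀ {r n} .{{_ : NonZero n}} {shape : Vec ℕ r}
  (S T : RSYT n shape) {a b k} →
  Interchanged S T a b → a ∈ rowSet S k → b ∈ rowSet S k → des S ⊆ des T
interchanged-sameRow⇒des⊆ S T {a} {b} {k} S↔T a∈ b∈ x∈ with ∈⟦⟧⁻ (isDescent? S) x∈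
... | l , l′ , l<l′ , x∈l , x⊕1∈l′ = ∈⟦⟧⁺ (isDescent? T) (l , l′ , l<l′ , move x∈l , move x⊕1∈l′)
  where
  move : ∀ {x l} → x ∈ rowSet S l → x ∈ rowSet T l
  move {x} {l} x∈ with x Fin.≟ a | x Fin.≟ b
  ... | yes refl | _        = subst (λ m → a ∈ rowSet T m) (∈-uniqueRow S a∈ x∈) (interchanged-∈ʳ S T S↔T b∈)
  ... | no  _    | yes refl = subst (λ m → b ∈ rowSet T m) (∈-uniqueRow S b∈ x∈) (interchanged-∈ˡ S T S↔T a∈)
  ... | no  x≢a  | no  x≢b  = interchanged-∈-fixed S T S↔T x≢a x≢b x∈

-- Descents and interchanges in two-row tableaux.

module _ {n : ℕ} .{{_ : NonZero n}} {λ₁ λ₂ : ℕ} where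

  private
    Tableau : Set
    Tableau = RSYT n (λ₁ ∷ λ₂ ∷ [])

  ∈¹⊎∈² : (s : Tableau) (x : Fin n) → x ∈ s ¹ ⊎ x ∈ s ²
  ∈¹⊎∈² s x with ∈-someRow s x
  ... | zero     , x∈ = inj₁ x∈
  ... | suc zero , x∈ = inj₂ x∈

  ∈¹⇒∉² : (s : Tableau) {x : Fin n} → x ∈ s ¹ → ¬ x ∈ s ²
  ∈¹⇒∉² s x∈¹ x∈² with ∈-uniqueRow s x∈¹ x∈²
  ... | ()

  ∈des⁺ : (s : Tableau) {x : Fin n} → x ∈ s ¹ → x ⊕ 1 ∈ s ² → x ∈ des s
  ∈des⁺ s x∈ x⊕1∈ = ∈⟦⟧⁺ (isDescent? s) (zero , suc zero , ℕ.s≤s ℕ.z≤n , x∈ , x⊕1∈)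

  ∈des⁻ : (s : Tableau) {x : Fin n} → x ∈ des s → x ∈ s ¹ × x ⊕ 1 ∈ s ²
  ∈des⁻ s x∈ with ∈⟦⟧⁻ (isDescent? s) x∈
  ... | zero     , zero     , ()    , _
  ... | zero     , suc zero , _     , x∈¹ , x⊕1∈² = x∈¹ , x⊕1∈²
  ... | suc zero , zero     , ()    , _
  ... | suc zero , suc zero , ℕ.s≤s () , _

  module _ (s t : Tableau) where

    -- The entry `c` is in the bottom row of `s` and the top row of `t`. Only `a` and `b` can change
    -- rows, and `a` starts on top, so `c` is `b`. The argument for `d` is dual.
    opposite-interchanges : ∀ {a b c d} →
      a ∈ s ¹ → b ∈ s ² → Interchanged s t a b →
      c ∈ t ¹ → d ∈ t ² → Interchanged t s c d →
      c ≡ b × d ≡ a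
    opposite-interchanges {a} {b} {c} {d} a∈ b∈ s↔t c∈ d∈ t↔s = c≡b , d≡a
      where
      c∈s² : c ∈ s ²
      c∈s² = interchanged-∈ʳ t s t↔s d∈

      d∈s¹ : d ∈ s ¹
      d∈s¹ = interchanged-∈ˡ t s t↔s c∈

      c≡b : c ≡ b
      c≡b with c Fin.≟ a | c Fin.≟ b
      ... | _        | yes eq = eq
      ... | yes refl | no _   = contradiction c∈s² (∈¹⇒∉² s a∈)
      ... | no c≢a   | no c≢b = contradiction (interchanged-∈-fixed s t s↔t c≢a c≢b c∈s²) (∈¹⇒∉² t c∈)

      d≡a : d ≡ a
      d≡a with d Fin.≟ a | d Fin.≟ b
      ... | yes eq | _        = eq
      ... | no _   | yes refl = contradiction b∈ (∈¹⇒∉² s d∈s¹)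
      ... | no d≢a | no d≢b   = contradiction d∈ (∈¹⇒∉² t (interchanged-∈-fixed s t s↔t d≢a d≢b d∈s¹))

    module _ {i : Fin n} (i∈ : i ∈ s ¹) (i⊕1∈ : i ⊕ 1 ∈ s ²) (s↔t : Interchanged s t i (i ⊕ 1)) where

      private
        i∈t² : i ∈ t ²
        i∈t² = interchanged-∈ʳ s t s↔t i⊕1∈

        i⊕1∈t¹ : i ⊕ 1 ∈ t ¹
        i⊕1∈t¹ = interchanged-∈ˡ s t s↔t i∈

      -- The descent `i` of `s` is lost, since `i` moves to the bottom row.
      des⊈des-interchanged : ¬ (des s ⊆ des t)
      des⊈des-interchanged s⊆t =
        ∈¹⇒∉² t (proj₁ (∈des⁻ t (s⊆t (∈des⁺ s i∈ i⊕1∈)))) i∈t²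

      -- The new descent of `t` is `i ⊖ 1` in the first case and `i ⊕ 1` in the second.
      des-interchanged⊈des : i ⊖ 1 ∈ t ¹ ⊎ i ⊕ 1 ⊕ 1 ∈ t ² → ¬ (des t ⊆ des s)
      des-interchanged⊈des (inj₁ i⊖1∈) t⊆s = ∈¹⇒∉² s i∈ (subst (_∈ s ²) (⊖-1-⊕-1 i)
        (proj₂ (∈des⁻ s (t⊆s (∈des⁺ t i⊖1∈ (subst (_∈ t ²) (sym (⊖-1-⊕-1 i)) i∈t²))))))
      des-interchanged⊈des (inj₂ i⊕2∈) t⊆s =
        ∈¹⇒∉² s (proj₁ (∈des⁻ s (t⊆s (∈des⁺ t i⊕1∈t¹ i⊕2∈)))) i⊕1∈

      -- The hypotheses keep `i ⊖ 1` and `i ⊕ 1` from being descents of `t`, and `i` is none either.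
      -- So neither `x` nor `x ⊕ 1` is an interchanged entry, and both keep their rows.
      des-interchanged⊆des : i ⊖ 1 ∈ t ² → i ⊕ 1 ⊕ 1 ∈ t ¹ → des t ⊆ des s
      des-interchanged⊆des i⊖1∈ i⊕2∈ {x} x∈des with ∈des⁻ t x∈des
      ... | x∈ , x⊕1∈ = ∈des⁺ s
        (interchanged-∈-fixed t s t↔s x≢i x≢i⊕1 x∈)
        (interchanged-∈-fixed t s t↔s x⊕1≢i (x≢i ∘ ⊕-1-injective) x⊕1∈)
        where
        t↔s = interchanged-sym s t s↔t

        x≢i : x ≢ i
        x≢i refl = ∈¹⇒∉² t x∈ i∈t²

        x≢i⊕1 : x ≢ i ⊕ 1
        x≢i⊕1 refl = ∈¹⇒∉² t i⊕2∈ x⊕1∈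

        x⊕1≢i : x ⊕ 1 ≢ i
        x⊕1≢i refl = ∈¹⇒∉² t x∈ (subst (_∈ t ²) (⊕-1-⊖-1 x) i⊖1∈)

      interchanged⇒knuth : i ⊖ 1 ∈ t ¹ ⊎ i ⊕ 1 ⊕ 1 ∈ t ² → KnuthMove s t
      interchanged⇒knuth i⊖1∈⊎i⊕2∈ =
        des⊈des-interchanged , des-interchanged⊈des i⊖1∈⊎i⊕2∈ , i , s↔t

      -- For neighbouring entries every condition of the second kind is automatic except the
      -- disjunction, which is the contrapositive of `des-interchanged⊆des`.
      ¬des-interchanged⊆des⇒secondKind : n ≥ 3 → ¬ (des t ⊆ des s) → SecondKind t s
      ¬des-interchanged⊆des⇒secondKind n≥3 t⊈s = i , i ⊕ 1 ,
        i∈t² , i⊕1∈t¹ , interchanged-sym s t s↔t , ⊕-1⊕-1≢ n≥3 i ∘ sym ,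
        cong (_% 2) (distance-⊕-1 {λ₁ = λ₁} {λ₂} i) , i⊕1∈t¹ ,
        subst (_∈ t ²) (sym (⊕-1-⊖-1 i)) i∈t² , i⊖1∈⊎i⊕2∈ ,
        -- Here `half` is 0, so the range of `k` is empty.
        (λ k 1≤k k≤half → contradiction
          (ℕ.≤-trans 1≤k (subst (k ℕ.≤_) (half-⊕-1 {λ₁ = λ₁} {λ₂} i) k≤half)) λ()) ,
        (λ i⊕1≢i⊕1 → contradiction refl i⊕1≢i⊕1)
        where
        i⊖1∈⊎i⊕2∈ : i ⊖ 1 ∈ t ¹ ⊎ i ⊕ 1 ⊕ 1 ∈ t ²
        i⊖1∈⊎i⊕2∈ with ∈¹⊎∈² t (i ⊖ 1) | ∈¹⊎∈² t (i ⊕ 1 ⊕ 1)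
        ... | inj₁ i⊖1∈ | _         = inj₁ i⊖1∈
        ... | inj₂ _    | inj₂ i⊕2∈ = inj₂ i⊕2∈
        ... | inj₂ i⊖1∈ | inj₁ i⊕2∈ = ⊥-elim (t⊈s (des-interchanged⊆des i⊖1∈ i⊕2∈))

  -- Edges in both directions versus Knuth moves.

  Edge : Rel Tableau 0ℓ
  Edge s t = FirstKind s t ⊎ SecondKind s t

  knuth-sym : (s t : Tableau) → KnuthMove s t → KnuthMove t s
  knuth-sym s t (s⊈t , t⊈s , i , s↔t) = t⊈s , s⊈t , i , interchanged-sym s t s↔t

  -- The edge of the first kind starts at the tableau with `i` on top; incomparability of the
  -- descent sets supplies the edge of the second kind back.
  knuth⇒edges : n ≥ 3 → (s t : Tableau) → KnuthMove s t → Edge s t × Edge t s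
  knuth⇒edges n≥3 s t (s⊈t , t⊈s , i , s↔t) with ∈¹⊎∈² s i | ∈¹⊎∈² s (i ⊕ 1)
  ... | inj₁ i∈ | inj₁ i⊕1∈ = ⊥-elim (s⊈t (interchanged-sameRow⇒des⊆ s t s↔t i∈ i⊕1∈))
  ... | inj₂ i∈ | inj₂ i⊕1∈ = ⊥-elim (s⊈t (interchanged-sameRow⇒des⊆ s t s↔t i∈ i⊕1∈))
  ... | inj₁ i∈ | inj₂ i⊕1∈ =
    inj₁ (i , i∈ , i⊕1∈ , s↔t) ,
    inj₂ (¬des-interchanged⊆des⇒secondKind s t i∈ i⊕1∈ s↔t n≥3 t⊈s)
  ... | inj₂ i∈ | inj₁ i⊕1∈ =
    inj₂ (¬des-interchanged⊆des⇒secondKind t s i∈t i⊕1∈t t↔s n≥3 s⊈t) ,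
    inj₁ (i , i∈t , i⊕1∈t , t↔s)
    where
    t↔s   = interchanged-sym s t s↔t
    i∈t   = interchanged-∈ʳ s t s↔t i⊕1∈
    i⊕1∈t = interchanged-∈ˡ s t s↔t i∈

  first∧second⇒knuth : (s t : Tableau) → FirstKind s t → SecondKind t s → KnuthMove s t
  first∧second⇒knuth s t (i , i∈ , i⊕1∈ , s↔t) (k , l , k∈ , l∈ , t↔s , _ , _ , _ , _ , k⊖1∈⊎l⊕1∈ , _)
    with opposite-interchanges s t i∈ i⊕1∈ s↔t l∈ k∈ (interchanged-comm t s t↔s)
  -- Now `k` is `i` and `l` is `i ⊕ 1`, so the disjunction of the second kind is the one that
  -- creates a new descent in `t`.
  ... | refl , refl = interchanged⇒knuth s t i∈ i⊕1∈ s↔t k⊖1∈⊎l⊕1∈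

  edges⇒knuth : n ≥ 3 → (s t : Tableau) → Edge s t → Edge t s → KnuthMove s t
  edges⇒knuth n≥3 s t (inj₁ (i , i∈ , i⊕1∈ , s↔t)) (inj₁ (k , k∈ , k⊕1∈ , t↔s))
    with opposite-interchanges s t i∈ i⊕1∈ s↔t k∈ k⊕1∈ t↔s
  -- Here `k` is `i ⊕ 1` and `k ⊕ 1` is `i`.
  ... | refl , i⊕2≡i = contradiction i⊕2≡i (⊕-1⊕-1≢ n≥3 i)
  edges⇒knuth _ s t (inj₁ first)  (inj₂ second) = first∧second⇒knuth s t first second
  edges⇒knuth _ s t (inj₂ second) (inj₁ first)  = knuth-sym t s (first∧second⇒knuth t s first second)
  edges⇒knuth n≥3 s t
    (inj₂ (i , j , i∈ , j∈ , s↔t , i≢j⊕1 , _ , i⊕1∈ , j⊖1∈ , i⊖1∈⊎j⊕1∈ , _))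
    (inj₂ (k , l , k∈ , l∈ , t↔s , k≢l⊕1 , _ , k⊕1∈ , l⊖1∈ , _))
    with opposite-interchanges s t j∈ i∈ (interchanged-comm s t s↔t) l∈ k∈ (interchanged-comm t s t↔s)
  -- Now `k` is `j` and `l` is `i`, so the second edge puts `i ⊖ 1` in `t ²` and `j ⊕ 1` in `t ¹`.
  -- Both differ from `i` and `j`, by `i≢j⊕1` and `n ≥ 2`, and hence lie in the same rows of `s`.
  ... | refl , refl = case i⊖1∈⊎j⊕1∈ of λ where
      (inj₁ i⊖1∈) → contradiction
        (interchanged-∈-fixed t s t↔s i⊖1≢j (⊖-1≢ i) l⊖1∈) (∈¹⇒∉² s i⊖1∈)
      (inj₂ j⊕1∈) → contradiction j⊕1∈ (∈¹⇒∉² s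
        (interchanged-∈-fixed t s t↔s (⊕-1≢ n≥2 j) (i≢j⊕1 ∘ sym) k⊕1∈))
    where
    n≥2 : n ≥ 2
    n≥2 = ℕ.<⇒≤ n≥3

    i⊖1≢j : i ⊖ 1 ≢ j
    i⊖1≢j eq = i≢j⊕1 (trans (sym (⊖-1-⊕-1 i)) (cong (_⊕ 1) eq))

    ⊖-1≢ : ∀ x → x ⊖ 1 ≢ x
    ⊖-1≢ x eq = ⊕-1≢ n≥2 x (trans (cong (_⊕ 1) (sym eq)) (⊖-1-⊕-1 x))

-- Graph weights as indicators.

indicator≈1⁺ : ∀ {P : Set} (P? : Dec P) → P → indicator P? ≈ 1ᴸ
indicator≈1⁺ P? p k rewrite dec-true P? p = refl

indicator≈1⁻ : ∀ {P : Set} (P? : Dec P) → indicator P? ≈ 1ᴸ → P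
indicator≈1⁻ P? ≈1 = indicator≉0⇒ P? (≈1⇒≉0 (indicator P?) ≈1)

-- Equivalent propositions have the same Boolean decision, so both sides are the same formal sum.
indicator-⇔ : ∀ {P Q : Set} (P? : Dec P) (Q? : Dec Q) → P ⇔ Q → indicator P? ≈ indicator Q?
indicator-⇔ P? Q? P⇔Q k = cong (λ b → coeff (if b then 1ᴸ else 0ᴸ) k) (does-⇔ P⇔Q P? Q?)

proposition4p8 : (n : ℕ) .{{_ : NonZero n}} → n ≥ 3 →
    (λ₁ λ₂ : ℕ) → λ₁ ≥ λ₂ → λ₂ ≥ 1 → λ₁ + λ₂ ≡ n →
    U (Γ-bar {n} λ₁ λ₂) ≈ᴳ D-bar {n = n} (λ₁ ∷ λ₂ ∷ [])
proposition4p8 n n≥3 λ₁ λ₂ _ _ _ =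
  -- Both weights are indicators, so it remains to match mutual edges with Knuth moves; the labels
  -- are `des` on both sides.
  (λ s t → indicator-⇔ (simple? (Γ-bar λ₁ λ₂) s t) (knuthMove? s t) (mk⇔
    (λ (st , ts) → edges⇒knuth n≥3 s t (indicator≈1⁻ (edge? s t) st) (indicator≈1⁻ (edge? t s) ts))
    (λ knuth → let st , ts = knuth⇒edges n≥3 s t knuth in
      indicator≈1⁺ (edge? s t) st , indicator≈1⁺ (edge? t s) ts))) ,
  (λ _ → refl)
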